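{- Let $A$ be a set of actions. Then $\mathsf{cMil}\precsim\mathsf{Mil}$, that is, every theorem of $\mathsf{cMil}$ is a theorem of $\mathsf{Mil}$. Moreover, every derivation in $\mathsf{cMil}$ with conclusion $e=f$ can be transformed effectively into a derivation in $\mathsf{Mil}$ that has the same conclusion.
   Context: **Star expressions.** For a set $A$ of actions, the set $StExp(A)$ of star expressions is generated by $e ::= 0\mid 1\mid a\mid (e_1+e_2)\mid (e_1\cdot e_2)\mid e^*$ with $a\in A$. $\sum_{i=1}^n e_i$ is $0$ for $n=0$, $e_1$ for $n=1$, and $(\sum_{i=1}^{n-1}e_i)+e_n$ for $n>1$. $Eq(A)$ is the set of formal equations $e=f$ with $e,f\in StExp(A)$. Immediate termination $e{\downarrow}$ is defined inductively by: $1{\downarrow}$; $(e_1+e_2){\downarrow}$ if $e_1{\downarrow}$ or $e_2{\downarrow}$; $(e_1\cdot e_2){\downarrow}$ if $e_1{\downarrow}$ and $e_2{\downarrow}$; $(e^*){\downarrow}$ always. Write $e{\not\downarrow}$ if $e{\downarrow}$ does not hold. **Proof systems.** An $Eq(A)$-based proof system is a Hilbert-style proof system whose formulas are the equations in $Eq(A)$; $e=_S f$ means that $e=f$ is derivable in $S$ without assumptions (is a theorem of $S$). It is $\mathcal{EL}$-based if its rules include those of equational logic: reflexivity, symmetry, transitivity, and the context rule (from $e=f$ infer $C[e]=C[f]$ for one-hole star expression contexts $C$). $S+\Gamma$ adds the equations in $\Gamma\subseteq Eq(A)$ as axioms to $S$; $S+R$ adds the rule $R$. $\mathsf{ACI}$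 consists of the axioms $(e+f)+g=e+(f+g)$, $e+f=f+e$, $e+e=e$; $\mathsf{ACI}\sqsubseteq S$ means that all of these are axioms of $S$. $\mathsf{Mil}^-$ is the $\mathcal{EL}$-based system with exactly the rules of equational logic and the axiom schemes: $(e+f)+g=e+(f+g)$, $e+0=e$, $e+f=f+e$, $e+e=e$, $(e\cdot f)\cdot g=e\cdot(f\cdot g)$, $(e+f)\cdot g=e\cdot g+f\cdot g$, $1\cdot e=e$, $e\cdot 1=e$, $0\cdot e=0$, $e^*=1+e\cdot e^*$, $e^*=(1+e)^*$. Milner's system is $\mathsf{Mil}=\mathsf{Mil}^-+\mathrm{RSP}^*$, where $\mathrm{RSP}^*$ is the rule: from $e=f\cdot e+g$ infer $e=f^*\cdot g$, provided $f{\not\downarrow}$. **1-charts and solutions.** A 1-chart is $C=\langle V,A,1,v_s,\to,\downarrow\rangle$ with a finite set $V$ of vertices, a set $A$ of (proper) action labels, an empty-step label $1\notin A$, a start vertex $v_s\in V$, a transition relation $\to\,\subseteq V\times(A\cup\{1\})\times V$, and a set $\downarrow\,\subseteq V$ of vertices with immediate termination. Transitions with label in $A$ are proper; those with label $1$ are 1-transitions. $C$ is weakly guarded if it has no cycle of 1-transitions. For an $\mathcal{EL}$-based system $S$ with $\mathsf{ACI}\sqsubseteq S$, a function $s:V\to StExp(A)$ is an $S$-provable solution of $C$ if for every $v\in V$: $s(v)=_S\tau_C(v)+\sum_{i=1}^n\underline a_i\cdot s(v_i)$, where $v\xrightarrow{\underline a_i}v_i$ ($1\le i\le n$, $\underline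 a_i\in A\cup\{1\}$) is a (possibly redundant) list of all transitions from $v$, and $\tau_C(v)$ is $1$ if $v{\downarrow}$ and $0$ otherwise. **Guarded LLEE-1-charts.** A loop 1-chart is a 1-chart such that (L1) there is an infinite path from the start vertex, (L2) every infinite path from the start vertex returns to it after a positive number of transitions, (L3) immediate termination is only permitted at the start vertex. Its transitions from the start vertex are its loop-entry transitions, all other transitions belong to its body. A loop sub-1-chart of $C$ is a loop 1-chart $L$ that is a sub-1-chart of $C$ with some vertex $v$ of $C$ as start vertex, formed, for a nonempty set $U$ of transitions of $C$ from $v$ (the loop-entry transitions of $L$), by all vertices and transitions on paths that start with a transition in $U$ and continue onward until $v$ is reached again. A multi-step loop elimination of loop sub-1-charts $L_1,\dots,L_n$ ($n\ge1$) from $C$, where their sets of loop-entry transitions are pairwise disjoint and no start vertex of one is in the body of another one, removes all loop-entry transitions of $L_1,\dots,L_n$, and then all vertices and transitions that become unreachable. A run (sequence of multi-steps) from $C$ is successful if it leads to a 1-chart without an infinite path; it is layered if it never removes loop-entry transitions that depart from a vertex in the body of a previously eliminated loop sub-1-chart. A LLEE-witness of $C$ is the labeling of the transitions of $C$ by natural numbers that records a successful layered run: marking label $n\ge1$ for transitions removed as loop-entry transitions in the $n$-th multi-step ('loop-entry transitions'), label $0$ for all other transitions ('body transitions'). It is guarded if all of its loop-entry transitions are proper. A guarded LLEE-1-chart is a 1-chart that has a guarded LLEE-witness. **Coinductive proofs.** Let $S$ be $\mathcal{EL}$-based with $\mathsf{ACI}\sqsubseteq S$. A coinductive proof over $S$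 of $e_1=e_2$ is a pair $\langle C,L\rangle$ of a weakly guarded 1-chart $C$ with start vertex $v_s$ and a function $L:V(C)\to Eq(A)$, $v\mapsto (L_1(v)=L_2(v))$, such that $L_1$ and $L_2$ are $S$-provable solutions of $C$ and $L_1(v_s)\equiv e_1$, $L_2(v_s)\equiv e_2$ (syntactic equality). It is LLEE-witnessed if $C$ is a guarded LLEE-1-chart. $e_1\overset{\mathrm{LLEE}}{=}_S e_2$ means that there is a LLEE-witnessed coinductive proof over $S$ of $e_1=e_2$. **The system $\mathsf{cMil}$.** For $n\in\mathbb N$ (including $0$), the rule $\mathrm{LCoProof}_n$ permits to infer $e=f$ from premises $g_1=h_1,\dots,g_n=h_n$ provided $e\overset{\mathrm{LLEE}}{=}_{\mathsf{Mil}^-+\Gamma}f$ for $\Gamma=\{g_1=h_1,\dots,g_n=h_n\}$. $\mathsf{cMil}$ is $\mathsf{Mil}^-$ extended by all rules $\mathrm{LCoProof}_n$, $n\in\mathbb N$. -}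

module Defs where

open import Level using (Level; 0ℓ; _⊔_) renaming (suc to lsuc)
open import Data.Bool using (if_then_else_)
open import Data.Empty using (⊥)
open import Data.Fin using (Fin; zero; suc)
open import Data.Fin.Subset using (Subset) renaming (_∈_ to _∈ₛ_)
open import Data.Fin.Subset.Properties using () renaming (_∈?_ to _∈ₛ?_)
open import Data.List using (List; []; _∷_; foldl; map)
open import Data.List.Membership.Propositional using (_∈_)
open import Data.List.Relation.Unary.All using (All)
open import Data.Nat using (ℕ; zero; suc)
open import Data.Product using (Σ; ∃; ∃₂; _×_; _,_; proj₁)
open import Data.Sum using (_⊎_; inj₁; inj₂)
open import Data.Unit.Polymorphic using (⊤)
open import Function.Bundles using (_⇔_)
open import Relation.Binary.Construct.Closure.ReflexiveTransitive using (Star; ε; _◅_; _◅◅_)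
open import Relation.Binary.Construct.Closure.Transitive using (TransClosure)
open import Relation.Binary.PropositionalEquality using (_≡_; _≢_; refl)
open import Relation.Nullary using (¬_; does)
open import Relation.Unary using (Pred)

------------------------------------------------------------------------
-- Star expressions

infixl 6 _+_
infixl 7 _·_
infix  8 _*

data StExp (A : Set) : Set where
  𝟘 𝟙     : StExp A
  act     : A → StExp A
  _+_ _·_ : StExp A → StExp A → StExp A
  _*      : StExp A → StExp A

∑ : {A : Set} → List (StExp A) → StExp A
∑ []       = 𝟘
∑ (e ∷ es) = foldl _+_ e es

infix 4 _↓ _↓̸

data _↓ {A : Set} : StExp A → Set where
  𝟙↓  : 𝟙 ↓
  +↓₁ : ∀ {e f} → e ↓ → (e + f) ↓
  +↓₂ : ∀ {e f} → f ↓ → (e + f) ↓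
  ·↓  : ∀ {e f} → e ↓ → f ↓ → (e · f) ↓
  *↓  : ∀ {e} → (e *) ↓

_↓̸ : {A : Set} → StExp A → Set
e ↓̸ = ¬ (e ↓)

infix 3 _≐_

-- Formal equations.
record Eq (A : Set) : Set where
  constructor _≐_
  field
    lhs rhs : StExp A

open Eq public

-- One-hole contexts.
data Ctx (A : Set) : Set where
  □   : Ctx A
  _+ˡ_ : Ctx A → StExp A → Ctx A
  _+ʳ_ : StExp A → Ctx A → Ctx A
  _·ˡ_ : Ctx A → StExp A → Ctx A
  _·ʳ_ : StExp A → Ctx A → Ctx A
  _*ᶜ  : Ctx A → Ctx A

_[_] : {A : Set} → Ctx A → StExp A → StExp A
□        [ e ] = e
(C +ˡ f) [ e ] = C [ e ] + f
(f +ʳ C) [ e ] = f + C [ e ]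
(C ·ˡ f) [ e ] = C [ e ] · f
(f ·ʳ C) [ e ] = f · C [ e ]
(C *ᶜ)   [ e ] = (C [ e ]) *

------------------------------------------------------------------------
-- Hilbert-style proof systems

-- A system is its set of rule instances (premises, conclusion); axioms are
-- rule instances without premises.
System : Set → (ℓ : Level) → Set (lsuc ℓ)
System A ℓ = List (Eq A) → Eq A → Set ℓ

infix 2 _⊢_

-- S ⊢ φ is the type of derivations in S, without assumptions, of φ.
data _⊢_ {A : Set} {ℓ : Level} (S : System A ℓ) : Eq A → Set ℓ where
  infer : ∀ {Γ φ} → S Γ φ → All (S ⊢_) Γ → S ⊢ φ

Derivation : {A : Set} {ℓ : Level} → System A ℓ → Set ℓ
Derivation S = ∃ (S ⊢_)

conclusion : {A : Set} {ℓ : Level} {S : System A ℓ} → Derivation S → Eq A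
conclusion = proj₁

infix 2 _≾_

-- Every theorem of the first system is a theorem of the second.
_≾_ : {A : Set} {ℓ₁ ℓ₂ : Level} → System A ℓ₁ → System A ℓ₂ → Set (ℓ₁ ⊔ ℓ₂)
S ≾ T = ∀ e f → S ⊢ (e ≐ f) → T ⊢ (e ≐ f)

infixl 5 _+Rules_ _+Axioms_

_+Rules_ : {A : Set} {ℓ₁ ℓ₂ : Level} →
           System A ℓ₁ → System A ℓ₂ → System A (ℓ₁ ⊔ ℓ₂)
(S +Rules R) Γ φ = S Γ φ ⊎ R Γ φ

data Axioms {A : Set} {ℓ : Level} (P : Pred (Eq A) ℓ) : System A ℓ where
  axiom : ∀ {φ} → P φ → Axioms P [] φ

_+Axioms_ : {A : Set} {ℓ₁ ℓ₂ : Level} →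
            System A ℓ₁ → Pred (Eq A) ℓ₂ → System A (ℓ₁ ⊔ ℓ₂)
S +Axioms P = S +Rules Axioms P

data EL (A : Set) : System A 0ℓ where
  reflexivity  : ∀ {e} → EL A [] (e ≐ e)
  symmetry     : ∀ {e f} → EL A ((e ≐ f) ∷ []) (f ≐ e)
  transitivity : ∀ {e f g} → EL A ((e ≐ f) ∷ (f ≐ g) ∷ []) (e ≐ g)
  context      : ∀ {e f} (C : Ctx A) → EL A ((e ≐ f) ∷ []) (C [ e ] ≐ C [ f ])

data Mil⁻-Axiom (A : Set) : Pred (Eq A) 0ℓ where
  +-assoc     : ∀ {e f g} → Mil⁻-Axiom A ((e + f) + g ≐ e + (f + g))
  +-identity  : ∀ {e}     → Mil⁻-Axiom A (e + 𝟘 ≐ e)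
  +-comm      : ∀ {e f}   → Mil⁻-Axiom A (e + f ≐ f + e)
  +-idem      : ∀ {e}     → Mil⁻-Axiom A (e + e ≐ e)
  ·-assoc     : ∀ {e f g} → Mil⁻-Axiom A ((e · f) · g ≐ e · (f · g))
  ·-distribʳ  : ∀ {e f g} → Mil⁻-Axiom A ((e + f) · g ≐ e · g + f · g)
  ·-identityˡ : ∀ {e}     → Mil⁻-Axiom A (𝟙 · e ≐ e)
  ·-identityʳ : ∀ {e}     → Mil⁻-Axiom A (e · 𝟙 ≐ e)
  ·-zeroˡ     : ∀ {e}     → Mil⁻-Axiom A (𝟘 · e ≐ 𝟘)
  *-unfold    : ∀ {e}     → Mil⁻-Axiom A (e * ≐ 𝟙 + e · e *)
  *-𝟙+        : ∀ {e}     → Mil⁻-Axiom A (e * ≐ (𝟙 + e) *)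

Mil⁻ : (A : Set) → System A 0ℓ
Mil⁻ A = EL A +Axioms Mil⁻-Axiom A

data RSP* (A : Set) : System A 0ℓ where
  rsp* : ∀ {e f g} → f ↓̸ → RSP* A ((e ≐ f · e + g) ∷ []) (e ≐ f * · g)

Mil : (A : Set) → System A 0ℓ
Mil A = Mil⁻ A +Rules RSP* A

------------------------------------------------------------------------
-- 1-charts

data Label (A : Set) : Set where
  𝟏      : Label A
  proper : A → Label A

⟦_⟧ : {A : Set} → Label A → StExp A
⟦ 𝟏 ⟧        = 𝟙
⟦ proper a ⟧ = act a

-- The finite vertex set is Fin size.
record 1-Chart (A : Set) : Set₁ where
  field
    size        : ℕ
    start       : Fin size
    _─⟨_⟩→_     : Fin size → Label A → Fin size → Set
    terminating : Subset size

  Vertex : Set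
  Vertex = Fin size

  WeaklyGuarded : Set
  WeaklyGuarded = ∀ v → ¬ TransClosure (λ u w → u ─⟨ 𝟏 ⟩→ w) v v

  τ : Vertex → StExp A
  τ v = if does (v ∈ₛ? terminating) then 𝟙 else 𝟘

  -- ts is a (possibly redundant) list of all transitions from v.
  ListsTransitions : Vertex → List (Label A × Vertex) → Set
  ListsTransitions v ts = ∀ a w → ((a , w) ∈ ts) ⇔ (v ─⟨ a ⟩→ w)

  IsSolution : {ℓ : Level} → System A ℓ → (Vertex → StExp A) → Set ℓ
  IsSolution S s = ∀ v → ∃ λ ts → ListsTransitions v ts ×
    (S ⊢ (s v ≐ τ v + ∑ (map (λ (a , w) → ⟦ a ⟧ · s w) ts)))

------------------------------------------------------------------------
-- Loop elimination

module _ {A : Set} (C : 1-Chart A) where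
  open 1-Chart C

  -- Termination in a sub-1-chart is inherited from C on its vertices.
  record Sub-1-Chart : Set₁ where
    field
      root      : Vertex
      vertex    : Vertex → Set
      step      : Vertex → Label A → Vertex → Set
      step⊆     : ∀ {u a w} → step u a w → u ─⟨ a ⟩→ w
      root∈     : vertex root
      source∈   : ∀ {u a w} → step u a w → vertex u
      target∈   : ∀ {u a w} → step u a w → vertex w

  full : Sub-1-Chart
  full = record
    { root = start ; vertex = λ _ → ⊤ ; step = _─⟨_⟩→_ ; step⊆ = λ t → t
    ; root∈ = _ ; source∈ = _ ; target∈ = _ }

module _ {A : Set} {C : 1-Chart A} where
  open 1-Chart C
  open Sub-1-Chart

  record InfinitePath (D : Sub-1-Chart C) (v : Vertex) : Set where
    field
      vertexAt : ℕ → Vertex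
      labelAt  : ℕ → Label A
      begins   : vertexAt 0 ≡ v
      steps    : ∀ i → step D (vertexAt i) (labelAt i) (vertexAt (suc i))

  open InfinitePath

  record IsLoop (D : Sub-1-Chart C) : Set where
    field
      L1 : InfinitePath D (root D)
      L2 : (π : InfinitePath D (root D)) → ∃ λ i → vertexAt π (suc i) ≡ root D
      L3 : ∀ v → vertex D v → v ∈ₛ terminating → v ≡ root D

  -- The vertices reached, after at least one transition, on paths in D that
  -- start with a transition from v in U and continue until v is reached again
  -- (v itself is Visited iff some such path returns to it).
  data Visited (D : Sub-1-Chart C) (v : Vertex) (U : Label A → Vertex → Set) :
               Vertex → Set where
    enter    : ∀ {a w} → U a w → Visited D v U w
    continue : ∀ {u a w} → Visited D v U u → u ≢ v → step D u a w → Visited D v U w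

  -- A transition is a loop-entry transition or one of the body.
  data GenStep (D : Sub-1-Chart C) (v : Vertex) (U : Label A → Vertex → Set) :
               Vertex → Label A → Vertex → Set where
    entry : ∀ {a w} → U a w → GenStep D v U v a w
    body  : ∀ {u a w} → Visited D v U u → u ≢ v → step D u a w → GenStep D v U u a w

  generated : (D : Sub-1-Chart C) (v : Vertex) (U : Label A → Vertex → Set) →
              (∀ {a w} → U a w → step D v a w) → Sub-1-Chart C
  generated D v U U⊆ = record
    { root    = v
    ; vertex  = λ u → u ≡ v ⊎ Visited D v U u
    ; step    = GenStep D v U
    ; step⊆   = λ { (entry x) → step⊆ D (U⊆ x) ; (body _ _ t) → step⊆ D t }
    ; root∈   = inj₁ refl
    ; source∈ = λ { (entry _) → inj₁ refl ; (body x _ _) → inj₂ x }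
    ; target∈ = λ { (entry x) → inj₂ (enter x) ; (body x n t) → inj₂ (continue x n t) }
    }

  record LoopSub-1-Chart (D : Sub-1-Chart C) : Set₁ where
    field
      entryVertex : Vertex
      entries     : Label A → Vertex → Set
      nonempty    : ∃₂ entries
      entries⊆    : ∀ {a w} → entries a w → step D entryVertex a w
      isLoop      : IsLoop (generated D entryVertex entries entries⊆)

    -- The vertices from which only body transitions can depart.
    InBody : Vertex → Set
    InBody u = u ≢ entryVertex × Visited D entryVertex entries u

    EntryTransition : Vertex → Label A → Vertex → Set
    EntryTransition u a w = u ≡ entryVertex × entries a w

  open LoopSub-1-Chart

  record MultiStep (D : Sub-1-Chart C) : Set₁ where
    field
      pred-n : ℕ
      loops    : Fin (suc pred-n) → LoopSub-1-Chart D
      disjoint : ∀ {i j} → i ≢ j → ∀ {u a w} →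
                 ¬ (EntryTransition (loops i) u a w × EntryTransition (loops j) u a w)
      apart    : ∀ i j → ¬ InBody (loops i) (entryVertex (loops j))

    Removed : Vertex → Label A → Vertex → Set
    Removed u a w = ∃ λ i → EntryTransition (loops i) u a w

    InSomeBody : Vertex → Set
    InSomeBody u = ∃ λ i → InBody (loops i) u

    Kept : Vertex → Label A → Vertex → Set
    Kept u a w = step D u a w × ¬ Removed u a w

    Reachable : Vertex → Set
    Reachable = Star (λ u w → ∃ λ a → Kept u a w) (root D)

  open MultiStep

  -- Keeps exactly what is reachable from the root once the loop-entry
  -- transitions are removed.
  eliminate : (D : Sub-1-Chart C) → MultiStep D → Sub-1-Chart C
  eliminate D m = record
    { root    = root D
    ; vertex  = Reachable m
    ; step    = λ u a w → Reachable m u × Kept m u a w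
    ; step⊆   = λ (_ , t , _) → step⊆ D t
    ; root∈   = ε
    ; source∈ = λ (r , _) → r
    ; target∈ = λ (r , k) → r ◅◅ ((_ , k) ◅ ε)
    }

  data Run (D : Sub-1-Chart C) : Set₁ where
    done : Run D
    _▷_  : (m : MultiStep D) → Run (eliminate D m) → Run D

  final : ∀ {D} → Run D → Sub-1-Chart C
  final {D} done = D
  final (m ▷ r)  = final r

  Successful : ∀ {D} → Run D → Set
  Successful r = ¬ ∃ (InfinitePath (final r))

  -- B holds of the vertices in bodies of previously eliminated loops.
  LayeredAfter : (B : Vertex → Set) → ∀ {D} → Run D → Set
  LayeredAfter B done    = ⊤
  LayeredAfter B (m ▷ r) =
    (∀ i → ¬ B (entryVertex (loops m i))) ×
    LayeredAfter (λ u → B u ⊎ InSomeBody m u) r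

  Layered : ∀ {D} → Run D → Set
  Layered = LayeredAfter (λ _ → ⊥)

  -- The loop-entry transitions removed in multi-step n, counting from 1.
  RemovedAt : ∀ {D} → Run D → ℕ → Vertex → Label A → Vertex → Set
  RemovedAt done    _             u a w = ⊥
  RemovedAt (m ▷ r) 0             u a w = ⊥
  RemovedAt (m ▷ r) 1             u a w = Removed m u a w
  RemovedAt (m ▷ r) (suc (suc n)) u a w = RemovedAt r (suc n) u a w

module _ {A : Set} (C : 1-Chart A) where
  open 1-Chart C

  record LLEE-Witness : Set₁ where
    field
      marking    : Vertex → Label A → Vertex → ℕ
      run        : Run (full C)
      successful : Successful run
      layered    : Layered run
      -- Hence marking 0 for exactly those transitions that are never removed
      -- as loop-entry transitions.
      records    : ∀ {u a w} → u ─⟨ a ⟩→ w → ∀ n →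
                   (marking u a w ≡ suc n) ⇔ RemovedAt run (suc n) u a w

    Guarded : Set
    Guarded = ∀ {u a w} → u ─⟨ a ⟩→ w → marking u a w ≢ 0 → ∃ λ b → a ≡ proper b

  GuardedLLEE : Set₁
  GuardedLLEE = Σ LLEE-Witness LLEE-Witness.Guarded

------------------------------------------------------------------------
-- Coinductive proofs

record CoinductiveProof {A : Set} {ℓ : Level} (S : System A ℓ) (e₁ e₂ : StExp A) :
                        Set (lsuc 0ℓ ⊔ ℓ) where
  field
    chart         : 1-Chart A
  open 1-Chart chart
  field
    weaklyGuarded : WeaklyGuarded
    L             : Vertex → Eq A
    solution₁     : IsSolution S (λ v → lhs (L v))
    solution₂     : IsSolution S (λ v → rhs (L v))
    start₁        : lhs (L start) ≡ e₁
    start₂        : rhs (L start) ≡ e₂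

LLEE-Provable : {A : Set} {ℓ : Level} → System A ℓ → StExp A → StExp A →
                Set (lsuc 0ℓ ⊔ ℓ)
LLEE-Provable S e₁ e₂ =
  Σ (CoinductiveProof S e₁ e₂) λ P → GuardedLLEE (CoinductiveProof.chart P)

-- All rules LCoProofₙ at once; n is the length of Γ.
data LCoProof (A : Set) : System A (lsuc 0ℓ) where
  lcoproof : ∀ {Γ e f} → LLEE-Provable (Mil⁻ A +Axioms (_∈ Γ)) e f →
             LCoProof A Γ (e ≐ f)

cMil : (A : Set) → System A (lsuc 0ℓ)
cMil A = Mil⁻ A +Rules LCoProof A

{-# OPTIONS --safe #-}
module Submission where

-- Two provable solutions of a guarded LLEE-1-chart are compared by following the
-- run of loop eliminations. At every stage each vertex v carries an equation
--   s(v) = E · s(v) + (τ(v) + ∑ aᵢ · s(vᵢ))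
-- over the transitions that are still present, with E not terminating and the same
-- for both solutions. When a loop at v is eliminated, its body is acyclic (L2) and
-- does not terminate (L3), so RSP* yields s(w) = t · s(v) for the body vertices w,
-- with t independent of s; hence each removed entry transition a to w moves into E
-- as a · t, which does not terminate because a is proper. In the final 1-chart,
-- which is acyclic, RSP* turns the equations into one expression equal to both
-- solutions.

open import Defs
open import Data.Bool using (Bool; true; false; if_then_else_)
open import Data.Empty using (⊥-elim)
open import Data.Fin using (Fin)
open import Data.Fin.Properties using (_≟_)
open import Data.Fin.Induction using (spo-noetherian)
open import Data.Fin.Subset.Properties using () renaming (_∈?_ to _∈ₛ?_)
open import Data.List using (List; []; _∷_; foldl; foldr; map)
open import Data.List.Membership.Propositional using (_∈_)
open import Data.List.Relation.Unary.All as All using (All; []; _∷_)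
open import Data.List.Relation.Unary.Any using (here; there)
open import Data.Nat using (ℕ; zero; suc)
import Data.Nat.Properties as ℕ
open import Data.Product using (Σ; ∃; _×_; _,_; proj₁; proj₂)
open import Data.Sum using (_⊎_; inj₁; inj₂; [_,_]′)
open import Function using (flip; id; _∘_)
open import Function.Bundles using (Equivalence)
open import Induction.WellFounded using (Acc; acc; WellFounded)
open import Level using (0ℓ)
open import Relation.Binary using (Setoid; Rel)
open import Relation.Binary.Construct.Closure.ReflexiveTransitive using (Star; ε; _◅_)
open import Relation.Binary.Construct.Closure.Transitive using (TransClosure; [_]; _∷_; _++_)
open import Relation.Binary.PropositionalEquality
  using (_≡_; _≢_; refl; sym; subst; subst₂; isEquivalence; resp₂)
import Relation.Binary.Reasoning.Setoid as SetoidReasoning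
open import Relation.Nullary using (¬_; Dec; yes; no)
open import Relation.Nullary.Decidable using (map′)

-- Provable equality in Mil

infix 2 _≈_

_≈_ : {A : Set} → StExp A → StExp A → Set
_≈_ {A} e f = Mil A ⊢ e ≐ f

module _ {A : Set} where

  equational : ∀ {Γ} {φ : Eq A} → EL A Γ φ → All (Mil A ⊢_) Γ → Mil A ⊢ φ
  equational r = infer (inj₁ (inj₁ r))

  ax : ∀ {φ : Eq A} → Mil⁻-Axiom A φ → Mil A ⊢ φ
  ax α = infer (inj₁ (inj₂ (axiom α))) []

  ≈-refl : {e : StExp A} → e ≈ e
  ≈-refl = equational reflexivity []

  ≈-sym : {e f : StExp A} → e ≈ f → f ≈ e
  ≈-sym p = equational symmetry (p ∷ [])

  ≈-trans : {e f g : StExp A} → e ≈ f → f ≈ g → e ≈ g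
  ≈-trans p q = equational transitivity (p ∷ q ∷ [])

  ≈-setoid : Setoid 0ℓ 0ℓ
  ≈-setoid = record
    { Carrier = StExp A ; _≈_ = _≈_
    ; isEquivalence = record { refl = ≈-refl ; sym = ≈-sym ; trans = ≈-trans } }

  open SetoidReasoning ≈-setoid

  +-congˡ : {e f g : StExp A} → f ≈ g → e + f ≈ e + g
  +-congˡ p = equational (context (_ +ʳ □)) (p ∷ [])

  +-congʳ : {e f g : StExp A} → f ≈ g → f + e ≈ g + e
  +-congʳ p = equational (context (□ +ˡ _)) (p ∷ [])

  +-cong : {e f g h : StExp A} → e ≈ f → g ≈ h → e + g ≈ f + h
  +-cong p q = ≈-trans (+-congʳ p) (+-congˡ q)

  ·-congˡ : {e f g : StExp A} → f ≈ g → e · f ≈ e · g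
  ·-congˡ p = equational (context (_ ·ʳ □)) (p ∷ [])

  +-identityˡ : {e : StExp A} → 𝟘 + e ≈ e
  +-identityˡ = ≈-trans (ax +-comm) (ax +-identity)

  +-exchange : {e f g : StExp A} → e + (f + g) ≈ f + (e + g)
  +-exchange {e} {f} {g} = begin
    e + (f + g)  ≈⟨ ax +-assoc ⟨
    (e + f) + g  ≈⟨ +-congʳ (ax +-comm) ⟩
    (f + e) + g  ≈⟨ ax +-assoc ⟩
    f + (e + g)  ∎

  rsp : {e f g : StExp A} → f ↓̸ → e ≈ f · e + g → e ≈ f * · g
  rsp f↓̸ p = infer (inj₂ (rsp* f↓̸)) (p ∷ [])

  -- Puts the equation of a provable solution into the form it has before any elimination, with loop
  -- coefficient `𝟘`.
  𝟘-loop : ∀ {e f g : StExp A} → e ≈ f + g → e ≈ 𝟘 · e + (f + g)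
  𝟘-loop {e} {f} {g} p = begin
    e                ≈⟨ p ⟩
    f + g            ≈⟨ +-identityˡ ⟨
    𝟘 + (f + g)      ≈⟨ +-congʳ (ax ·-zeroˡ) ⟨
    𝟘 · e + (f + g)  ∎

  act·-↓̸ : ∀ {a} {e : StExp A} → (act a · e) ↓̸
  act·-↓̸ (·↓ () _)

  +-↓̸ : {e f : StExp A} → e ↓̸ → f ↓̸ → (e + f) ↓̸
  +-↓̸ p q (+↓₁ e↓) = p e↓
  +-↓̸ p q (+↓₂ f↓) = q f↓

  -- A right-nested variant of `∑` with a trailing `𝟘`, suited to induction on lists.
  sum : List (StExp A) → StExp A
  sum = foldr _+_ 𝟘

  foldl≈sum : ∀ e es → foldl _+_ e es ≈ e + sum es
  foldl≈sum e []       = ≈-sym (ax +-identity)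
  foldl≈sum e (f ∷ es) = ≈-trans (foldl≈sum (e + f) es) (ax +-assoc)

  ∑≈sum : ∀ es → ∑ es ≈ sum es
  ∑≈sum []       = ≈-refl
  ∑≈sum (e ∷ es) = foldl≈sum e es

  module _ {B : Set} (f : B → StExp A) where

    ∈-absorb : ∀ {x xs} → x ∈ xs → f x + sum (map f xs) ≈ sum (map f xs)
    ∈-absorb (here refl) = ≈-trans (≈-sym (ax +-assoc)) (+-congʳ (ax +-idem))
    ∈-absorb (there p)   = ≈-trans +-exchange (+-congˡ (∈-absorb p))

    ⊆-absorb : ∀ xs {ys} → (∀ {x} → x ∈ xs → x ∈ ys) →
               sum (map f xs) + sum (map f ys) ≈ sum (map f ys)
    ⊆-absorb []       xs⊆ = +-identityˡ
    ⊆-absorb (x ∷ xs) {ys} xs⊆ = begin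
      (f x + sum (map f xs)) + sum (map f ys)  ≈⟨ ax +-assoc ⟩
      f x + (sum (map f xs) + sum (map f ys))  ≈⟨ +-congˡ (⊆-absorb xs (xs⊆ ∘ there)) ⟩
      f x + sum (map f ys)                     ≈⟨ ∈-absorb (xs⊆ (here refl)) ⟩
      sum (map f ys)                           ∎

    -- Each of the two sums absorbs the other. This permits exchanging lists of the same transitions
    -- that differ in order or repetitions.
    sum-cong-∈ : ∀ xs ys → (∀ {x} → x ∈ xs → x ∈ ys) → (∀ {x} → x ∈ ys → x ∈ xs) →
                 sum (map f xs) ≈ sum (map f ys)
    sum-cong-∈ xs ys xs⊆ ys⊆ = begin
      sum (map f xs)                   ≈⟨ ⊆-absorb ys ys⊆ ⟨
      sum (map f ys) + sum (map f xs)  ≈⟨ ax +-comm ⟩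
      sum (map f xs) + sum (map f ys)  ≈⟨ ⊆-absorb xs xs⊆ ⟩
      sum (map f ys)                   ∎

  summand : {V : Set} → (V → StExp A) → Label A × V → StExp A
  summand s (a , w) = ⟦ a ⟧ · s w

  -- The coefficient `c` is chosen before `i`: a single left factor serves all solutions at once.
  MultipleOf : {I : Set} → (I → StExp A) → (I → StExp A) → Set
  MultipleOf h e = ∃ λ c → ∀ i → e i ≈ c · h i

-- Acyclicity and infinite paths

-- The transitive closure of an acyclic relation is a strict partial order, and `Fin n` is finite.
acyclic⇒noetherian : ∀ {n} {R : Rel (Fin n) 0ℓ} → (∀ u → ¬ TransClosure R u u) →
                     WellFounded (flip (TransClosure R))
acyclic⇒noetherian acyclic = spo-noetherian record
  { isEquivalence = isEquivalence
  ; irrefl        = λ { refl → acyclic _ }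
  ; trans         = _++_
  ; <-resp-≈      = resp₂ _ }

module _ {A : Set} {C : 1-Chart A} where
  open 1-Chart C
  open Sub-1-Chart
  open InfinitePath
  open LoopSub-1-Chart
  open MultiStep

  -- Unrolls a closed path into an infinite one. A `Position` stores the non-empty rest of the way
  -- to `u`, so that an outgoing edge always exists.
  module Cycle {D : Sub-1-Chart C} {R : Rel Vertex 0ℓ}
               (R⇒step : ∀ {u w} → R u w → ∃ λ a → step D u a w)
               {u : Vertex} (c : TransClosure R u u) where

    Position : Set
    Position = ∃ λ w → TransClosure R w u

    next : Position → Position
    -- The last edge leads to `u`, where the walk starts again along `c`.
    next (w , [ _ ])   = u , c
    next (w , (_ ∷ p)) = _ , p

    edge : (p : Position) → R (proj₁ p) (proj₁ (next p))
    edge (w , [ r ])   = r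
    edge (w , (r ∷ _)) = r

    position : ℕ → Position
    position zero    = u , c
    position (suc i) = next (position i)

    path : InfinitePath D u
    path = record
      { vertexAt = proj₁ ∘ position
      ; labelAt  = λ i → proj₁ (R⇒step (edge (position i)))
      ; begins   = refl
      ; steps    = λ i → proj₂ (R⇒step (edge (position i))) }

  prepend : ∀ {D : Sub-1-Chart C} {u a w} → step D u a w →
            InfinitePath D w → InfinitePath D u
  prepend {D} {u} {a} t π = record
    { vertexAt = λ { zero → u ; (suc i) → vertexAt π i }
    ; labelAt  = λ { zero → a ; (suc i) → labelAt π i }
    ; begins   = refl
    ; steps    = λ { zero → subst (step D u a) (sym (begins π)) t ; (suc i) → steps π i } }

  -- The resulting path never returns to v, contrary to (L2).
  visited⇒escape :
    ∀ {D : Sub-1-Chart C} {v U} (U⊆ : ∀ {a w} → U a w → step D v a w) →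
    let G = generated D v U U⊆ in
    ∀ {u} → Visited D v U u → (π : InfinitePath G u) → (∀ i → vertexAt π i ≢ v) →
    Σ (InfinitePath G v) λ ρ → ∀ i → vertexAt ρ (suc i) ≢ v
  visited⇒escape U⊆ (enter x) π avoids = prepend (entry x) π , avoids
  visited⇒escape U⊆ (continue x u≢v t) π avoids =
    visited⇒escape U⊆ x (prepend (body x u≢v t) π) λ { zero → u≢v ; (suc i) → avoids i }

  reachable⇒vertex : ∀ {D : Sub-1-Chart C} (m : MultiStep D) {v} → Reachable m v → vertex D v
  reachable⇒vertex {D} m = go (root∈ D)
    where
    go : ∀ {u v} → vertex D u → Star (λ x y → ∃ λ a → Kept m x a y) u v → vertex D v
    go u∈ ε                 = u∈
    go u∈ ((_ , t , _) ◅ r) = go (target∈ D t) r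

  -- Systems of equations along a run of loop eliminations

  Edge : (D : Sub-1-Chart C) (inside : Vertex → Set) → Rel Vertex 0ℓ
  Edge D inside u w = inside u × inside w × ∃ λ a → step D u a w

  -- I indexes the solutions to be compared; the coefficients found below must not
  -- depend on it.
  module _ {I : Set} (s : I → Vertex → StExp A) where
    open SetoidReasoning (≈-setoid {A})

    branches : I → List (Label A × Vertex) → StExp A
    branches i ts = sum (map (summand (s i)) ts)

    -- Only `holds` mentions `i`: the loop coefficient and the list are common to all solutions. By
    -- `listed`, the summands of removed transitions have to disappear at an elimination.
    record Equation (T : Label A → Vertex → Set) (v : Vertex) : Set where
      field
        loop   : StExp A
        loop↓̸  : loop ↓̸
        list   : List (Label A × Vertex)
        listed : All (λ (a , w) → T a w) list
        holds  : ∀ i → s i v ≈ loop · s i v + (τ v + branches i list)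

    Equations : Sub-1-Chart C → Set
    Equations D = ∀ {v} → vertex D v → Equation (step D v) v

    -- Noetherian induction along the edges, with one use of RSP* per vertex. It is instantiated
    -- twice: for a loop body, with `h` the solutions at the entry vertex, and for the whole final
    -- 1-chart, with `h` constantly `𝟙`.
    module AcyclicRegion
      {D : Sub-1-Chart C} (equations : Equations D) (h : I → StExp A)
      (inside : Vertex → Set)
      (inside⊆ : ∀ {u} → inside u → vertex D u)
      (acyclic : ∀ u → ¬ TransClosure (Edge D inside) u u)
      (termination : ∀ {u} → inside u → MultipleOf h (λ _ → τ u))
      (exit : ∀ {u a w} → inside u → step D u a w → inside w ⊎ MultipleOf h (λ i → s i w))
      where

      Solved : Vertex → Set
      Solved u = MultipleOf h (λ i → s i u)

      branches-multiple : ∀ {T : Label A → Vertex → Set} → (∀ {a w} → T a w → Solved w) →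
                          ∀ {ts} → All (λ (a , w) → T a w) ts →
                          MultipleOf h (λ i → branches i ts)
      branches-multiple solved [] = 𝟘 , λ i → ≈-sym (ax ·-zeroˡ)
      branches-multiple solved {(a , w) ∷ ts} (t ∷ l)
        with c , p ← solved t | d , q ← branches-multiple solved l =
        ⟦ a ⟧ · c + d , λ i → begin
          ⟦ a ⟧ · s i w + branches i ts   ≈⟨ +-cong (·-congˡ (p i)) (q i) ⟩
          ⟦ a ⟧ · (c · h i) + d · h i     ≈⟨ +-congʳ (ax ·-assoc) ⟨
          (⟦ a ⟧ · c) · h i + d · h i     ≈⟨ ax ·-distribʳ ⟨
          (⟦ a ⟧ · c + d) · h i           ∎

      solve-from : ∀ {u} → inside u → (∀ {a w} → step D u a w → Solved w) → Solved u
      solve-from {u} u∈ solved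
        with record { loop = E ; loop↓̸ = E↓̸ ; list = ts ; listed = l ; holds = eq }
               ← equations (inside⊆ u∈)
        with c , p ← termination u∈ | d , q ← branches-multiple solved l =
        E * · (c + d) , λ i → ≈-trans (rsp E↓̸ (begin
          s i u                                ≈⟨ eq i ⟩
          E · s i u + (τ u + branches i ts)    ≈⟨ +-congˡ (+-cong (p i) (q i)) ⟩
          E · s i u + (c · h i + d · h i)      ≈⟨ +-congˡ (ax ·-distribʳ) ⟨
          E · s i u + (c + d) · h i            ∎)) (≈-sym (ax ·-assoc))

      solve-acc : ∀ {u} → Acc (flip (TransClosure (Edge D inside))) u → inside u → Solved u
      solve-acc (acc rs) u∈ = solve-from u∈ λ t →
        [ (λ w∈ → solve-acc (rs ([ u∈ , w∈ , _ , t ])) w∈) , id ]′ (exit u∈ t)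

      solve : ∀ {u} → inside u → Solved u
      solve = solve-acc (acyclic⇒noetherian acyclic _)

    module Body {D : Sub-1-Chart C} (equations : Equations D) (l : LoopSub-1-Chart D) where
      v = entryVertex l
      open IsLoop (isLoop l)

      Inside : Vertex → Set
      Inside u = Visited D v (entries l) u × u ≢ v

      inside⊆ : ∀ {u} → Inside u → vertex D u
      inside⊆ (enter x , _)        = target∈ D (entries⊆ l x)
      inside⊆ (continue _ _ t , _) = target∈ D t

      -- A cycle that avoids `v` could be entered from `v` and then followed forever.
      acyclic : ∀ u → ¬ TransClosure (Edge D Inside) u u
      acyclic u c with visited⇒escape (entries⊆ l) (proj₁ u∈) path avoids
        where
        R⇒step : ∀ {x y} → Edge D Inside x y →
                 ∃ λ a → step (generated D v (entries l) (entries⊆ l)) x a y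
        R⇒step ((x∈ , x≢v) , _ , a , t) = a , body x∈ x≢v t
        open Cycle R⇒step c
        u∈ : Inside u
        u∈ = proj₁ (edge (position 0))
        avoids : ∀ i → vertexAt path i ≢ v
        avoids i = proj₂ (proj₁ (edge (position i)))
      ... | ρ , escapes with j , returns ← L2 ρ = escapes j returns

      -- `Visited` includes a return to `v` itself; there the coefficient is `𝟙`.
      split : ∀ {w} → Visited D v (entries l) w →
              Inside w ⊎ MultipleOf (λ i → s i v) (λ i → s i w)
      split {w} x with w ≟ v
      ... | yes refl = inj₂ (𝟙 , λ i → ≈-sym (ax ·-identityˡ))
      ... | no w≢v   = inj₁ (x , w≢v)

      -- By (L3) `τ u` is `𝟘`, a multiple of everything; `𝟙` would in general not be provably of the
      -- form `c · s i v`.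
      termination : ∀ {u} → Inside u → MultipleOf (λ i → s i v) (λ _ → τ u)
      termination {u} (x , u≢v) with u ∈ₛ? terminating
      ... | yes u↓ = ⊥-elim (u≢v (L3 u (inj₂ x) u↓))
      ... | no _   = 𝟘 , λ i → ≈-sym (ax ·-zeroˡ)

      open AcyclicRegion {D = D} equations (λ i → s i v) Inside inside⊆ acyclic termination
        (λ (x , u≢v) t → split (continue x u≢v t))

      multipleOf-entry : ∀ {w} → Visited D v (entries l) w →
                         MultipleOf (λ i → s i v) (λ i → s i w)
      multipleOf-entry x = [ solve , id ]′ (split x)

    module Elimination
      {D : Sub-1-Chart C} (equations : Equations D) (m : MultiStep D)
      (removed? : ∀ {u a w} → step D u a w → Dec (Removed m u a w))
      (removed-proper : ∀ {u a w} → Removed m u a w → ∃ λ b → a ≡ proper b)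
      where

      -- `F` collects the coefficients `act b · c` of the removed transitions; their leading proper
      -- action prevents termination, whatever `c` is.
      splitRemoved : ∀ {v ts} → All (λ (a , w) → step D v a w) ts →
        ∃ λ F → ∃ λ us → F ↓̸ × All (λ (a , w) → Kept m v a w) us ×
        (∀ i → branches i ts ≈ F · s i v + branches i us)
      splitRemoved [] = 𝟘 , [] , (λ ()) , [] , λ i → ≈-sym (begin
        𝟘 · _ + 𝟘  ≈⟨ ax +-identity ⟩
        𝟘 · _      ≈⟨ ax ·-zeroˡ ⟩
        𝟘          ∎)
      splitRemoved {v} {(a , w) ∷ ts} (t ∷ l)
        with F , us , F↓̸ , k , eq ← splitRemoved l | removed? t
      ... | no ¬r = F , (a , w) ∷ us , F↓̸ , (t , ¬r) ∷ k , λ i →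
            ≈-trans (+-congˡ (eq i)) +-exchange
      -- `refl` identifies `v` with the entry vertex of loop `j`, so solving its body gives a
      -- multiple of `s i v` itself.
      ... | yes r@(j , refl , x)
        with b , refl ← removed-proper r
           | c , p ← Body.multipleOf-entry equations (loops m j) (enter x) =
        act b · c + F , us , +-↓̸ act·-↓̸ F↓̸ , k , λ i → begin
          act b · s i w + branches i ts                     ≈⟨ +-cong (·-congˡ (p i)) (eq i) ⟩
          act b · (c · s i v) + (F · s i v + branches i us) ≈⟨ +-congʳ (ax ·-assoc) ⟨
          (act b · c) · s i v + (F · s i v + branches i us) ≈⟨ ax +-assoc ⟨
          ((act b · c) · s i v + F · s i v) + branches i us ≈⟨ +-congʳ (ax ·-distribʳ) ⟨
          (act b · c + F) · s i v + branches i us           ∎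

      -- Elimination leaves `τ v` unchanged, so the new multiple of `s i v` is moved past it and
      -- merged with the old one by right distributivity.
      equations-eliminate : Equations (eliminate D m)
      equations-eliminate {v} v∈
        with record { loop = E ; loop↓̸ = E↓̸ ; list = ts ; listed = l ; holds = eq }
               ← equations (reachable⇒vertex m v∈)
        with F , us , F↓̸ , k , split ← splitRemoved l = record
        { loop   = E + F
        ; loop↓̸  = +-↓̸ E↓̸ F↓̸
        ; list   = us
        ; listed = All.map (v∈ ,_) k
        ; holds  = λ i → begin
            s i v                                                  ≈⟨ eq i ⟩
            E · s i v + (τ v + branches i ts)                      ≈⟨ +-congˡ (+-congˡ (split i)) ⟩
            E · s i v + (τ v + (F · s i v + branches i us))        ≈⟨ +-congˡ +-exchange ⟩
            E · s i v + (F · s i v + (τ v + branches i us))        ≈⟨ ax +-assoc ⟨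
            (E · s i v + F · s i v) + (τ v + branches i us)        ≈⟨ +-congʳ (ax ·-distribʳ) ⟨
            (E + F) · s i v + (τ v + branches i us)                ∎ }

    -- Induction on the run. The hypotheses on removed transitions range over all multi-steps, so
    -- that they pass to the remaining run with the index shifted by one.
    solve-run : ∀ {D} (r : Run D) → Successful r →
      (∀ n {u a w} → step D u a w → Dec (RemovedAt r (suc n) u a w)) →
      (∀ n {u a w} → step D u a w → RemovedAt r (suc n) u a w → ∃ λ b → a ≡ proper b) →
      Equations D → MultipleOf (λ _ → 𝟙) (λ i → s i (root D))
    solve-run {D} done successful _ _ equations = solve (root∈ D)
      where
      open AcyclicRegion {D = D} equations (λ _ → 𝟙) (vertex D) id
        -- A cycle in the final 1-chart would yield an infinite path.
        (λ u c → successful (u , Cycle.path (λ (_ , _ , at) → at) c))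
        (λ {u} _ → τ u , λ _ → ≈-sym (ax ·-identityʳ))
        (λ _ t → inj₁ (target∈ D t))
    solve-run {D} (m ▷ r) successful removed? removed-proper equations =
      solve-run r successful
        (λ n (_ , t , _) → removed? (suc n) t)
        (λ n (_ , t , _) → removed-proper (suc n) t)
        equations-eliminate
      where
      proper₁ : ∀ {u a w} → Removed m u a w → ∃ λ b → a ≡ proper b
      -- Index `0` denotes the first multi-step, because `RemovedAt` counts from 1.
      proper₁ r@(j , refl , x) = removed-proper 0 (entries⊆ (loops m j) x) r
      open Elimination equations m (removed? 0) proper₁

-- Coinductive proofs

-- Axioms from `Γ` are leaves of the derivation and are replaced by their derivations in `Mil`; all
-- other rules belong to `Mil` already.
⊢-axioms-admissible : ∀ {A Γ} {φ : Eq A} → All (Mil A ⊢_) Γ →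
                      Mil⁻ A +Axioms (_∈ Γ) ⊢ φ → Mil A ⊢ φ
⊢-axioms-admissible {A} {Γ} Γ⊢ = go
  where
  go  : ∀ {φ} → Mil⁻ A +Axioms (_∈ Γ) ⊢ φ → Mil A ⊢ φ
  go* : ∀ {Δ} → All (Mil⁻ A +Axioms (_∈ Γ) ⊢_) Δ → All (Mil A ⊢_) Δ
  go (infer (inj₁ r) ds)          = infer (inj₁ r) (go* ds)
  go (infer (inj₂ (axiom φ∈)) []) = All.lookup Γ⊢ φ∈
  go* []       = []
  go* (d ∷ ds) = go d ∷ go* ds

module _ {A : Set} {Γ : List (Eq A)} (Γ⊢ : All (Mil A ⊢_) Γ) where

  LLEE-sound : ∀ {e f} → LLEE-Provable (Mil⁻ A +Axioms (_∈ Γ)) e f → e ≈ f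
  LLEE-sound (P , witness , guarded) = subst₂ _≈_ start₁ start₂ (same (solve-run s
      (LLEE-Witness.run witness)
      (LLEE-Witness.successful witness)
      -- Loop entries are arbitrary predicates; comparing the recorded marking numbers makes removal
      -- decidable.
      (λ n t → map′ (Equivalence.to (records t n)) (Equivalence.from (records t n))
                    (marking _ _ _ ℕ.≟ suc n))
      (λ n t r → guarded t (positive (Equivalence.from (records t n) r)))
      equations))
    where
    open CoinductiveProof P
    open 1-Chart chart
    open LLEE-Witness witness using (marking; records)

    s : Bool → Vertex → StExp A
    s b v = if b then lhs (L v) else rhs (L v)

    positive : ∀ {m n} → m ≡ suc n → m ≢ 0
    positive refl ()

    same : MultipleOf (λ _ → 𝟙) (λ i → s i start) → s true start ≈ s false start
    same (c , p) = ≈-trans (p true) (≈-sym (p false))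

    equations : Equations s (full chart)
    equations {v} _ with ts , all , eq ← solution₁ v | us , all′ , eq′ ← solution₂ v = record
      { loop   = 𝟘
      ; loop↓̸  = λ ()
      ; list   = ts
      ; listed = All.tabulate (Equivalence.to (all _ _))
      ; holds  = λ { true  → 𝟘-loop (≈-trans (⊢-axioms-admissible Γ⊢ eq) (+-congˡ sum₁))
                   ; false → 𝟘-loop (≈-trans (⊢-axioms-admissible Γ⊢ eq′) (+-congˡ sum₂)) } }
      where
      sum₁ = ∑≈sum (map (summand (s true)) ts)
      -- The second solution may come with a different list `us` of the same transitions; its sum is
      -- converted to the shared list `ts`.
      sum₂ = ≈-trans (∑≈sum (map (summand (s false)) us))
        (sum-cong-∈ (summand (s false)) us ts
          (Equivalence.from (all _ _) ∘ Equivalence.to (all′ _ _))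
          (Equivalence.from (all′ _ _) ∘ Equivalence.to (all _ _)))

-- Translation of derivations

module _ {A : Set} where

  -- Translating the premises first provides `Mil` derivations of the axioms used by the coinductive
  -- proof. The recursion is itself the effective transformation.
  cMil⇒Mil  : ∀ {φ} → cMil A ⊢ φ → Mil A ⊢ φ
  cMil⇒Mil* : ∀ {Γ} → All (cMil A ⊢_) Γ → All (Mil A ⊢_) Γ
  cMil⇒Mil (infer (inj₁ r) ds)            = infer (inj₁ r) (cMil⇒Mil* ds)
  cMil⇒Mil (infer (inj₂ (lcoproof p)) ds) = LLEE-sound (cMil⇒Mil* ds) p
  cMil⇒Mil* []       = []
  cMil⇒Mil* (d ∷ ds) = cMil⇒Mil d ∷ cMil⇒Mil* ds

theorem6p11 : (A : Set) →
    (cMil A ≾ Mil A) ×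
    Σ (Derivation (cMil A) → Derivation (Mil A)) (λ transform →
    ∀ d → conclusion {S = Mil A} (transform d) ≡ conclusion {S = cMil A} d)
theorem6p11 A =
  (λ _ _ → cMil⇒Mil) , (λ (φ , d) → φ , cMil⇒Mil d) , (λ _ → refl)
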